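{- For every integer $n\ge1$, $$\mathrm{Pnest}_{\mathcal A(n)}(t)=\sum_{i=1}^{\lceil n/2\rceil}\binom{n}{2i-1}t^i=\frac{\sqrt t}{2}\Bigl[(1+\sqrt t)^n-(1-\sqrt t)^n\Bigr],$$ where $\mathrm{Pnest}_{\mathcal A(n)}(t)=\sum_{\mathbf a\in\mathcal A(n)}t^{\mathrm{pnest}(\mathbf a)}$ and $\mathcal A(n)$ is the set of Abelian area sequences of size $n$.
   Context: Write $[n]=\{1,\dots,n\}$. An area sequence of size $n$ is a sequence $\mathbf a=(a_1,\dots,a_n)$ of nonnegative integers with $a_i<i$ for all $i$ and $a_i\le a_{i-1}+1$ for all $i\ge 2$. Each area sequence $\mathbf a$ defines a graph $\Gamma_{\mathbf a}$ (a unit interval graph) on $[n]$ with edges $\{j,i\}$ for $1\le j<i\le n$ with $i-a_i\le j$. If $\{i,j\}$ with $i<j$ is an edge then $\{i,i+1,\dots,j\}$ is a clique. A peak-edge of $\Gamma_{\mathbf a}$ is either an isolated vertex $i$ (put $j=i$) or an edge $\{i,j\}$, $i<j$, such that neither $\{i,j+1\}$ nor $\{i-1,j\}$ is an edge (pairs not contained in $[n]$ are not edges). The corresponding peak-clique is $\{i,i+1,\dots,j\}$. The peak-nesting of a vertex is the number of peak-cliques containing it, and $\mathrm{pnest}(\mathbf a)$ is the maximum of these numbers over all vertices. An area sequence $\mathbf a$ of size $n$ is Abelian if every vertex $i\ne 1,n$ of $\Gamma_{\mathbf a}$ is adjacent to at least one of the vertices $1$ and $n$. -}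

module Defs where

open import Algebra.Bundles using (CommutativeRing)
open import Data.Fin.Base as Fin using (Fin; toℕ)
open import Data.Fin.Properties as Fin using (all?; any?; toℕ<n)
open import Data.List.Base
  using (List; []; _∷_; [_]; length; map; foldr; filter; upTo; allFin;
         cartesianProduct; cartesianProductWith)
open import Data.List.Extrema.Nat using (max)
open import Data.List.Membership.Propositional using (_∈_)
open import Data.List.Membership.Propositional.Properties
  using (∈-cartesianProductWith⁺; ∈-filter⁺; ∈-filter⁻; ∈-upTo⁺)
open import Data.List.Relation.Unary.All as All using ()
open import Data.List.Relation.Unary.AllPairs using ([]; _∷_)
open import Data.List.Relation.Unary.Any using (here)
open import Data.List.Relation.Unary.Unique.Propositional using (Unique)
open import Data.List.Relation.Unary.Unique.Propositional.Properties
  using (cartesianProductWith⁺; filter⁺; upTo⁺)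
open import Data.Nat.Base using (ℕ; zero; suc; _+_; _∸_; _≤_; _<_)
open import Data.Nat.Properties as ℕ using (_≤?_; _<?_; ≤-trans)
open import Data.Product.Base using (_×_; _,_; proj₁; proj₂; ∃-syntax)
open import Data.Sum.Base using (_⊎_)
open import Data.Vec.Base as Vec using (Vec; []; _∷_; lookup)
open import Data.Vec.Properties using (∷-injective)
open import Function.Base using (_∘_)
open import Function.Bundles using (_⇔_; mk⇔)
open import Relation.Binary.PropositionalEquality.Core using (_≡_; _≢_; refl)
open import Relation.Nullary.Decidable.Core
  using (Dec; ¬?; _×-dec_; _⊎-dec_; _→-dec_)
open import Relation.Nullary.Negation.Core using (¬_)

-- The element  k : Fin n  stands for the element  label k  of [n] = {1,…,n}.

label : ∀ {n} → Fin n → ℕ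
label k = suc (toℕ k)

IsAreaSequence : ∀ {n} → Vec ℕ n → Set
IsAreaSequence {n} a =
  (∀ (i : Fin n) → lookup a i < label i) ×
  (∀ (h i : Fin n) → label i ≡ suc (label h) → lookup a i ≤ lookup a h + 1)

-- The monus is exact on area sequences, where  lookup a i < label i.

Edge : ∀ {n} → Vec ℕ n → Fin n → Fin n → Set
Edge a j i = label j < label i × label i ∸ lookup a i ≤ label j

Adjacent : ∀ {n} → Vec ℕ n → Fin n → Fin n → Set
Adjacent a i j = Edge a i j ⊎ Edge a j i

Isolated : ∀ {n} → Vec ℕ n → Fin n → Set
Isolated a i = ∀ j → ¬ Adjacent a i j

-- A neighbour j + 1 or i - 1 lying outside [n] imposes no condition.

PeakEdge : ∀ {n} → Vec ℕ n → Fin n → Fin n → Set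
PeakEdge a i j =
  (j ≡ i × Isolated a i) ⊎
  (label i < label j × Adjacent a i j ×
   (∀ j⁺ → label j⁺ ≡ suc (label j) → ¬ Adjacent a i j⁺) ×
   (∀ i⁻ → label i ≡ suc (label i⁻) → ¬ Adjacent a i⁻ j))

_∈[_,_] : ∀ {n} → Fin n → Fin n → Fin n → Set
k ∈[ i , j ] = label i ≤ label k × label k ≤ label j

IsAbelian : ∀ {n} → Vec ℕ n → Set
IsAbelian {n} a =
  ∀ (i : Fin n) → label i ≢ 1 → label i ≢ n →
    ∃[ j ] ((label j ≡ 1 ⊎ label j ≡ n) × Adjacent a i j)

isAreaSequence? : ∀ {n} (a : Vec ℕ n) → Dec (IsAreaSequence a)
isAreaSequence? a =
  all? (λ i → lookup a i <? label i) ×-dec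
  all? (λ h → all? λ i →
    (label i ℕ.≟ suc (label h)) →-dec (lookup a i ≤? lookup a h + 1))

edge? : ∀ {n} (a : Vec ℕ n) j i → Dec (Edge a j i)
edge? a j i = (label j <? label i) ×-dec (label i ∸ lookup a i ≤? label j)

adjacent? : ∀ {n} (a : Vec ℕ n) i j → Dec (Adjacent a i j)
adjacent? a i j = edge? a i j ⊎-dec edge? a j i

isolated? : ∀ {n} (a : Vec ℕ n) i → Dec (Isolated a i)
isolated? a i = all? λ j → ¬? (adjacent? a i j)

peakEdge? : ∀ {n} (a : Vec ℕ n) i j → Dec (PeakEdge a i j)
peakEdge? a i j =
  ((j Fin.≟ i) ×-dec isolated? a i) ⊎-dec
  ((label i <? label j) ×-dec adjacent? a i j ×-dec
   all? (λ j⁺ → (label j⁺ ℕ.≟ suc (label j)) →-dec ¬? (adjacent? a i j⁺)) ×-dec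
   all? (λ i⁻ → (label i ℕ.≟ suc (label i⁻)) →-dec ¬? (adjacent? a i⁻ j)))

_∈[_,_]? : ∀ {n} (k i j : Fin n) → Dec (k ∈[ i , j ])
k ∈[ i , j ]? = (label i ≤? label k) ×-dec (label k ≤? label j)

isAbelian? : ∀ {n} (a : Vec ℕ n) → Dec (IsAbelian a)
isAbelian? {n} a = all? λ i →
  ¬? (label i ℕ.≟ 1) →-dec ¬? (label i ℕ.≟ n) →-dec
  any? (λ j → ((label j ℕ.≟ 1) ⊎-dec (label j ℕ.≟ n)) ×-dec adjacent? a i j)

-- The peak-clique {i,…,j} is determined by, and determines, its endpoints
-- i ≤ j, so peak-cliques are counted as pairs (i , j).

peakNesting : ∀ {n} → Vec ℕ n → Fin n → ℕ
peakNesting {n} a k =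
  length (filter (λ (i , j) → peakEdge? a i j ×-dec k ∈[ i , j ]?)
                 (cartesianProduct (allFin n) (allFin n)))

pnest : ∀ {n} → Vec ℕ n → ℕ
pnest {n} a = max 0 (map (peakNesting a) (allFin n))

vectors : List ℕ → ∀ n → List (Vec ℕ n)
vectors xs zero    = [ [] ]
vectors xs (suc n) = cartesianProductWith _∷_ xs (vectors xs n)

-- All entries of an area sequence of size n are smaller than n, so searching
-- {0,…,n-1}ⁿ misses none of them; ∈𝒜⇔ and 𝒜-unique below confirm that the list
-- contains every Abelian area sequence exactly once and nothing else.

𝒜 : ∀ n → List (Vec ℕ n)
𝒜 n = filter (λ a → isAreaSequence? a ×-dec isAbelian? a) (vectors (upTo n) n)

private
  ∈-vectors : ∀ {xs n} (a : Vec ℕ n) → (∀ i → lookup a i ∈ xs) → a ∈ vectors xs n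
  ∈-vectors []      _ = here refl
  ∈-vectors (_ ∷ a) p =
    ∈-cartesianProductWith⁺ _∷_ (p Fin.zero) (∈-vectors a (p ∘ Fin.suc))

  vectors-unique : ∀ {xs} → Unique xs → ∀ n → Unique (vectors xs n)
  vectors-unique u zero    = All.[] ∷ []
  vectors-unique u (suc n) =
    cartesianProductWith⁺ _∷_ ∷-injective u (vectors-unique u n)

∈𝒜⇔ : ∀ {n} (a : Vec ℕ n) → a ∈ 𝒜 n ⇔ (IsAreaSequence a × IsAbelian a)
∈𝒜⇔ {n} a = mk⇔
  (proj₂ ∘ ∈-filter⁻ P? {xs = vectors (upTo n) n})
  (λ p → ∈-filter⁺ P?
    (∈-vectors a (λ i → ∈-upTo⁺ (≤-trans (proj₁ (proj₁ p) i) (toℕ<n i)))) p)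
  where P? = λ (b : Vec ℕ n) → isAreaSequence? b ×-dec isAbelian? b

𝒜-unique : ∀ n → Unique (𝒜 n)
𝒜-unique n = filter⁺ _ (vectors-unique (upTo⁺ n) n)

-- Generating functions take values in an arbitrary commutative ring R.  An
-- identity valid for all R and all arguments is a polynomial identity, since R
-- may be a polynomial ring and the argument its indeterminate.

module GeneratingFunction {c ℓ} (R : CommutativeRing c ℓ) where
  open CommutativeRing R using (Carrier; semiring; 0#)
    renaming (_+_ to _+ᴿ_)
  open import Algebra.Properties.Semiring.Exp semiring public using (_^_)
  open import Algebra.Properties.Semiring.Mult semiring public
    using () renaming (_×_ to _·_)

  infix 5 ∑-syntax

  ∑-syntax : ∀ {A : Set} → List A → (A → Carrier) → Carrier
  ∑-syntax xs f = foldr (λ x s → f x +ᴿ s) 0# xs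

  syntax ∑-syntax xs (λ x → e) = ∑[ x ← xs ] e

  Pnest : ℕ → Carrier → Carrier
  Pnest n t = ∑[ a ← 𝒜 n ] t ^ pnest a

{-# OPTIONS --safe #-}
module Submission where

-- Put b_i = i − a_i, counting vertices from 0.  The sequence a is an Abelian area
-- sequence exactly when, for some p, b_i = 0 for i ≤ p and afterwards b increases
-- weakly with values in {1, …, p + 1}.  The peak-cliques are the intervals
-- [b_j , j] with j the last position of its value, and the vertex p lies in all of
-- them except possibly one, which starts at p + 1.  So p attains the maximal
-- nesting, namely 1 plus the number of values of b in {1, …, p}.  Reading b as a
-- lattice path, such a value is a corner where the path turns in one of the two
-- directions, and splitting the paths by their first step gives, for the sums over
-- all paths of given length, Pascal's recursion for the even and the odd part of
-- (1 + √t)ⁿ.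

open import Defs
open import Algebra.Bundles using (CommutativeRing)
open import Data.List.Base using (map; upTo)
open import Data.Nat.Base as ℕ using (ℕ; suc; _∸_; ⌈_/2⌉)
open import Data.Nat.Combinatorics using (_C_)
open import Data.Product.Base using (_×_)
open import Data.Bool.Base using (true; false; if_then_else_)
open import Data.Fin.Base using (Fin; zero; suc; toℕ; fromℕ; fromℕ<; inject₁)
open import Data.Fin.Properties using (toℕ-fromℕ; toℕ-injective; toℕ<n; toℕ-inject₁; toℕ-fromℕ<)
open import Data.List.Base
  using (List; []; _∷_; [_]; _++_; filter; length; allFin; tabulate; cartesianProduct)
open import Data.List.Extrema.Nat using (max; max≈v⁺)
open import Data.List.Properties using (length-map; map-upTo)
open import Data.List.Membership.Propositional using (_∈_)
open import Data.List.Membership.Propositional.Properties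
  using (∈-map⁺; ∈-map⁻; ∈-++⁺ˡ; ∈-++⁺ʳ; ∈-++⁻; ∈-filter⁺; ∈-filter⁻; ∈-allFin; ∈-cartesianProduct⁺)
open import Data.List.Membership.Propositional.Properties.WithK using (unique∧set⇒bag)
open import Data.List.Relation.Binary.BagAndSetEquality using (∼bag⇒↭)
open import Data.List.Relation.Binary.Permutation.Propositional as ↭ using (_↭_)
open import Data.List.Relation.Binary.Permutation.Propositional.Properties using (↭-length)
open import Data.List.Relation.Unary.All as All using ([])
import Data.List.Relation.Unary.All.Properties as All
open import Data.List.Relation.Unary.AllPairs using ([]; _∷_)
open import Data.List.Relation.Unary.Any using (here; there)
open import Data.List.Relation.Unary.Unique.Propositional using (Unique)
import Data.List.Relation.Unary.Unique.Propositional.Properties as Unique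
open import Data.Nat.Base using (zero; z≤n; s≤s; s≤s⁻¹)
open import Data.Nat.Combinatorics using (nCk+nC[k+1]≡[n+1]C[k+1])
import Data.Nat.Properties as ℕ
open import Data.Product.Base using (_,_; proj₁; proj₂; ∃-syntax)
open import Data.Product.Properties using (,-injectiveʳ)
open import Data.Sum.Base using (_⊎_; inj₁; inj₂)
open import Data.Unit.Base using (⊤; tt)
open import Data.Vec.Base using (Vec; []; _∷_; lookup)
open import Data.Vec.Properties using (∷-injectiveʳ)
open import Function.Base using (_∘_; id)
open import Function.Bundles using (_⇔_; mk⇔; Equivalence)
open import Relation.Binary.PropositionalEquality as ≡ using (_≡_)
open import Relation.Nullary.Decidable using (does-⇔; dec-true; dec-false)
open import Relation.Nullary.Decidable.Core using (Dec; yes; no; does; _×-dec_)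
open import Relation.Nullary.Negation.Core using (¬_; contradiction)

open Equivalence using (to; from)

module _ where
  open import Data.Nat.Base using (_+_; _≤_; _<_)
  open import Data.Nat.Properties
  open import Relation.Binary.PropositionalEquality
    using (refl; sym; trans; cong; cong₂; subst; module ≡-Reasoning)

  -- Adjacency without subtraction, and the monotonicity of `b_i = i - a_i`.

  edge⁻ : ∀ {n} (a : Vec ℕ n) {i j} → Edge a i j → toℕ i < toℕ j × toℕ j ≤ toℕ i + lookup a j
  edge⁻ a {i} {j} (i<j , p) = s≤s⁻¹ i<j ,
    s≤s⁻¹ (subst (suc (toℕ j) ≤_) (+-comm (lookup a j) _)
      (≤-trans (m≤n+m∸n (label j) (lookup a j)) (+-monoʳ-≤ (lookup a j) p)))

  edge⁺ : ∀ {n} (a : Vec ℕ n) {i j} → toℕ i < toℕ j → toℕ j ≤ toℕ i + lookup a j → Edge a i j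
  edge⁺ a {i} {j} i<j p = s≤s i<j ,
    m≤n+o⇒m∸n≤o (label j) (lookup a j) (subst (suc (toℕ j) ≤_) (+-comm _ (lookup a j)) (s≤s p))

  adjacent⁻ : ∀ {n} (a : Vec ℕ n) {i j} → toℕ i < toℕ j → Adjacent a i j →
              toℕ j ≤ toℕ i + lookup a j
  adjacent⁻ a _   (inj₁ e) = proj₂ (edge⁻ a e)
  adjacent⁻ a i<j (inj₂ e) = contradiction (proj₁ (edge⁻ a e)) (<-asym i<j)

  infixr 5 _∷_

  data Climbs : ∀ {n} → ℕ → Vec ℕ n → Set where
    []  : ∀ {x} → Climbs x []
    _∷_ : ∀ {n x y} {v : Vec ℕ n} → y ≤ x + 1 → Climbs y v → Climbs x (y ∷ v)

  climbs⁺ : ∀ {n} x (v : Vec ℕ n) →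
            (∀ h i → label i ≡ suc (label h) → lookup (x ∷ v) i ≤ lookup (x ∷ v) h + 1) →
            Climbs x v
  climbs⁺ x []      _    = []
  climbs⁺ x (y ∷ v) step =
    step zero (suc zero) refl ∷ climbs⁺ y v λ h i eq → step (suc h) (suc i) (cong suc eq)

  -- This is the weak monotonicity `h - a_h ≤ i - a_i` of `b`, written additively so that no
  -- truncated subtraction occurs.
  climbs-lookup : ∀ {n x} {v : Vec ℕ n} → Climbs x v → ∀ {h i} → toℕ h ≤ toℕ i →
                  toℕ h + lookup (x ∷ v) i ≤ toℕ i + lookup (x ∷ v) h
  climbs-lookup c {zero} {zero} _ = ≤-refl
  climbs-lookup {x = x} {y ∷ v} (y≤x+1 ∷ c) {zero} {suc i} _ = begin
    lookup (y ∷ v) i    ≤⟨ climbs-lookup c {zero} {i} z≤n ⟩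
    toℕ i + y           ≤⟨ +-monoʳ-≤ (toℕ i) y≤x+1 ⟩
    toℕ i + (x + 1)     ≡⟨ cong (toℕ i +_) (+-comm x 1) ⟩
    toℕ i + suc x       ≡⟨ +-suc (toℕ i) x ⟩
    suc (toℕ i + x)     ∎
    where open ≤-Reasoning
  climbs-lookup (_ ∷ c) {suc h} {suc i} h≤i = s≤s (climbs-lookup c (s≤s⁻¹ h≤i))

  lookup≤toℕ : ∀ {n} {v : Vec ℕ n} → Climbs 0 v → ∀ i → lookup (0 ∷ v) i ≤ toℕ i
  lookup≤toℕ {v = v} c i =
    subst (lookup (0 ∷ v) i ≤_) (+-identityʳ (toℕ i)) (climbs-lookup c {zero} {i} z≤n)

  isAreaSequence⁻ : ∀ {n x} {v : Vec ℕ n} → IsAreaSequence (x ∷ v) → x ≡ 0 × Climbs x v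
  isAreaSequence⁻ (bound , step) = n<1⇒n≡0 (bound zero) , climbs⁺ _ _ step

  isAreaSequence⁺ : ∀ {n} {v : Vec ℕ n} → Climbs 0 v → IsAreaSequence (0 ∷ v)
  isAreaSequence⁺ {v = v} c =
    (λ i → s≤s (lookup≤toℕ c i)) ,
    λ h i eq → +-cancelˡ-≤ (toℕ h) _ _ (begin
      toℕ h + lookup (0 ∷ v) i          ≤⟨ climbs-lookup c (<⇒≤ (≤-reflexive (sym (suc-injective eq)))) ⟩
      toℕ i + lookup (0 ∷ v) h          ≡⟨ cong (_+ lookup (0 ∷ v) h) (suc-injective eq) ⟩
      suc (toℕ h + lookup (0 ∷ v) h)    ≡⟨ +-comm 1 _ ⟩
      toℕ h + lookup (0 ∷ v) h + 1      ≡⟨ +-assoc (toℕ h) _ 1 ⟩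
      toℕ h + (lookup (0 ∷ v) h + 1)    ∎)
    where open ≤-Reasoning

  -- The Abelian condition and the shape of Abelian sequences.

  -- The vertices of w are numbered p, p + 1, …, p + n; the first alternative says
  -- that p + i is adjacent to vertex 0, the second that it is adjacent to p + n.
  Abelian : ∀ {n} → ℕ → Vec ℕ (suc n) → Set
  Abelian {n} p w =
    ∀ i → lookup w i ≡ p + toℕ i ⊎ n ≤ toℕ i + lookup w (fromℕ n)

  isAbelian⁻ : ∀ {n} {v : Vec ℕ n} → Climbs 0 v → IsAbelian (0 ∷ v) → Abelian 0 (0 ∷ v)
  isAbelian⁻ {n} {v} c ab i with toℕ i ℕ.≟ 0 | toℕ i ℕ.≟ n
  -- The two end vertices are exempt in `IsAbelian`; in `Abelian` each satisfies one of the
  -- alternatives trivially.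
  ... | yes i≡0 | _       = inj₁ (trans (cong (lookup (0 ∷ v)) (toℕ-injective {j = zero} i≡0)) (sym i≡0))
  ... | no _    | yes i≡n = inj₂ (≤-trans (≤-reflexive (sym i≡n)) (m≤m+n (toℕ i) _))
  ... | no i≢0  | no i≢n  with ab i (λ eq → i≢0 (suc-injective eq)) (λ eq → i≢n (suc-injective eq))
  ... | j , inj₁ j≡1 , inj₁ e =
    contradiction (subst (toℕ i <_) (suc-injective j≡1) (proj₁ (edge⁻ (0 ∷ v) e))) n≮0
  ... | j , inj₁ j≡1 , inj₂ e = inj₁ (≤-antisym
    (lookup≤toℕ c i)
    (subst (λ k → toℕ i ≤ k + lookup (0 ∷ v) i) (suc-injective j≡1) (proj₂ (edge⁻ (0 ∷ v) e))))
  ... | j , inj₂ j≡n , inj₁ e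
    with refl ← toℕ-injective {i = j} {fromℕ n} (trans (suc-injective j≡n) (sym (toℕ-fromℕ n))) =
    inj₂ (subst (_≤ toℕ i + lookup (0 ∷ v) (fromℕ n)) (toℕ-fromℕ n) (proj₂ (edge⁻ (0 ∷ v) e)))
  ... | j , inj₂ j≡n , inj₂ e =
    contradiction (proj₁ (edge⁻ (0 ∷ v) e)) (≤⇒≯ (s≤s⁻¹ (subst (label i ≤_) (sym j≡n) (toℕ<n i))))

  isAbelian⁺ : ∀ {n} {v : Vec ℕ n} → Abelian 0 (0 ∷ v) → IsAbelian (0 ∷ v)
  isAbelian⁺ {n} {v} ab i i≢1 i≢n with ab i
  ... | inj₁ eq = zero , inj₁ refl ,
    inj₂ (edge⁺ (0 ∷ v) (n≢0⇒n>0 λ i≡0 → i≢1 (cong suc i≡0)) (≤-reflexive (sym eq)))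
  ... | inj₂ n≤ = fromℕ n , inj₂ (cong suc (toℕ-fromℕ n)) ,
    inj₁ (edge⁺ (0 ∷ v)
      (subst (toℕ i <_) (sym (toℕ-fromℕ n)) (≤∧≢⇒< (s≤s⁻¹ (toℕ<n i)) λ i≡n → i≢n (cong suc i≡n)))
      (subst (_≤ toℕ i + lookup (0 ∷ v) (fromℕ n)) (sym (toℕ-fromℕ n)) n≤))

  -- With j = 0 at position p + 1 and b_i = i − a_i, the e of an entry is p + 1 − b_i.
  data Descent : ∀ {n} → ℕ → ℕ → Vec ℕ n → Set where
    []  : ∀ {j d} → Descent j d []
    _∷_ : ∀ {n j d e} {v : Vec ℕ n} → e ≤ d → Descent (suc j) e v → Descent j d (j + e ∷ v)

  -- Profile p v: the entries preceding v are 0, 1, …, p.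
  data Profile : ∀ {n} → ℕ → Vec ℕ n → Set where
    []   : ∀ {p} → Profile p []
    up   : ∀ {n p} {v : Vec ℕ n} → Profile (suc p) v → Profile p (suc p ∷ v)
    down : ∀ {n p x} {v : Vec ℕ n} → Descent 0 p (x ∷ v) → Profile p (x ∷ v)

  -- The last hypothesis bounds `b` by `p + 1` at the last vertex. Since `b` increases weakly, the
  -- bound holds at every entry, so each entry is at least its offset `j` and can be written
  -- `j + e`; the climbing condition makes `e` decrease weakly.
  climbs⇒descent : ∀ {n j d} e {v : Vec ℕ n} → e ≤ d → Climbs (j + e) v →
                   j + n ≤ lookup (j + e ∷ v) (fromℕ n) → Descent j d (j + e ∷ v)
  climbs⇒descent e e≤d [] _ = e≤d ∷ []
  climbs⇒descent {suc n} {j} e e≤d (_∷_ {y = y} {v} y≤ c) last≥ =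
    e≤d ∷ descends (m≤n⇒∃[o]m+o≡n 1+j≤y)
    where
    open ≤-Reasoning
    1+j≤y : suc j ≤ y
    1+j≤y = +-cancelʳ-≤ n (suc j) y (begin
      suc j + n                    ≡⟨ +-suc j n ⟨
      j + suc n                    ≤⟨ last≥ ⟩
      lookup (y ∷ v) (fromℕ n)     ≤⟨ climbs-lookup c {zero} {fromℕ n} z≤n ⟩
      toℕ (fromℕ n) + y            ≡⟨ cong (_+ y) (toℕ-fromℕ n) ⟩
      n + y                        ≡⟨ +-comm n y ⟩
      y + n                        ∎)
    descends : ∃[ e′ ] suc j + e′ ≡ y → Descent (suc j) e (y ∷ v)
    descends (e′ , refl) = climbs⇒descent e′
      (+-cancelˡ-≤ j _ _ (s≤s⁻¹ (subst (suc (j + e′) ≤_) (+-comm (j + e) 1) y≤)))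
      c (subst (_≤ lookup (y ∷ v) (fromℕ n)) (+-suc j n) last≥)

  descent⇒climbs : ∀ {n j d x} {v : Vec ℕ n} → j + d ≤ x + 1 → Descent j d v → Climbs x v
  descent⇒climbs _ [] = []
  descent⇒climbs {j = j} j+d≤ (_∷_ {e = e} e≤d D) =
    ≤-trans (+-monoʳ-≤ j e≤d) j+d≤ ∷ descent⇒climbs (≤-reflexive (+-comm 1 (j + e))) D

  descent-last : ∀ {n j d} {v : Vec ℕ (suc n)} → Descent j d v → j + n ≤ lookup v (fromℕ n)
  descent-last {zero}  {j} (_∷_ {e = e} _ []) = +-monoʳ-≤ j z≤n
  descent-last {suc n} {j} (_ ∷ D) = ≤-trans (≤-reflexive (+-suc j n)) (descent-last D)

  -- The Abelian condition matters at the first entry that breaks the run `0, 1, …, p`. The first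
  -- alternative fails there, so the second one holds and bounds `b` from that entry to the end.
  profile⁺ : ∀ {n p} {v : Vec ℕ n} → Climbs p v → Abelian p (p ∷ v) → Profile p v
  profile⁺ [] _ = []
  profile⁺ {p = p} (_∷_ {y = x} {v} x≤p+1 c) ab with x ℕ.≟ suc p
  ... | yes refl = up (profile⁺ c ab′)
    where
    ab′ : Abelian (suc p) (suc p ∷ v)
    ab′ i with ab (suc i)
    ... | inj₁ eq = inj₁ (trans eq (+-suc p (toℕ i)))
    ... | inj₂ n≤ = inj₂ (s≤s⁻¹ n≤)
  ... | no x≢1+p = down (climbs⇒descent x (s≤s⁻¹ (≤∧≢⇒< (subst (x ≤_) (+-comm p 1) x≤p+1) x≢1+p)) c last≥)
    where
    last≥ : _ ≤ lookup (x ∷ v) (fromℕ _)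
    last≥ with ab (suc zero)
    ... | inj₁ eq = contradiction (trans eq (+-comm p 1)) x≢1+p
    ... | inj₂ n≤ = s≤s⁻¹ n≤

  profile⇒climbs : ∀ {n p} {v : Vec ℕ n} → Profile p v → Climbs p v
  profile⇒climbs []       = []
  profile⇒climbs (up P)   = ≤-reflexive (+-comm 1 _) ∷ profile⇒climbs P
  profile⇒climbs (down D) = descent⇒climbs (m≤m+n _ 1) D

  profile⇒abelian : ∀ {n p} {v : Vec ℕ n} → Profile p v → Abelian p (p ∷ v)
  profile⇒abelian _        zero    = inj₁ (sym (+-identityʳ _))
  profile⇒abelian {p = p} (up P) (suc i) with profile⇒abelian P i
  ... | inj₁ eq = inj₁ (trans eq (sym (+-suc p (toℕ i))))
  ... | inj₂ n≤ = inj₂ (s≤s n≤)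
  profile⇒abelian (down D) (suc i) = inj₂ (s≤s (≤-trans (descent-last D) (m≤n+m _ (toℕ i))))

  -- Enumeration of the Abelian sequences.

  unique⇒↭ : ∀ {A : Set} {xs ys : List A} → Unique xs → Unique ys →
             (∀ {x} → x ∈ xs ⇔ x ∈ ys) → xs ↭ ys
  unique⇒↭ xs! ys! same = ∼bag⇒↭ (unique∧set⇒bag xs! ys! same)

  -- The recursion follows the steps of a lattice path: either an entry is placed at the current
  -- level `d`, or the level drops by one and no entry is placed. The generating functions are later
  -- split in the same way.
  descents : ℕ → ℕ → ∀ n → List (Vec ℕ n)
  descents j d       zero    = [ [] ]
  descents j zero    (suc n) = map (j + 0 ∷_) (descents (suc j) 0 n)
  descents j (suc d) (suc n) = map (j + suc d ∷_) (descents (suc j) (suc d) n) ++ descents j d (suc n)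

  profiles : ℕ → ∀ n → List (Vec ℕ n)
  profiles p zero    = [ [] ]
  profiles p (suc n) = map (suc p ∷_) (profiles (suc p) n) ++ descents 0 p (suc n)

  descent-weaken : ∀ {n j d d′} {v : Vec ℕ n} → d ≤ d′ → Descent j d v → Descent j d′ v
  descent-weaken _    []        = []
  descent-weaken d≤d′ (e≤d ∷ D) = ≤-trans e≤d d≤d′ ∷ D

  ∈-descents⁻ : ∀ {j} d {n} {v : Vec ℕ n} → v ∈ descents j d n → Descent j d v
  ∈-descents⁻ d       {zero}  (here refl) = []
  ∈-descents⁻ zero    {suc n} v∈ with _ , v∈′ , refl ← ∈-map⁻ _ v∈ = ≤-refl ∷ ∈-descents⁻ zero v∈′
  ∈-descents⁻ {j} (suc d) {suc n} v∈ with ∈-++⁻ (map (j + suc d ∷_) (descents (suc j) (suc d) n)) v∈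
  ... | inj₁ v∈ˡ with _ , v∈′ , refl ← ∈-map⁻ _ v∈ˡ = ≤-refl ∷ ∈-descents⁻ (suc d) v∈′
  ... | inj₂ v∈ʳ = descent-weaken (n≤1+n d) (∈-descents⁻ d v∈ʳ)

  ∈-descents⁺ : ∀ {j} d {n} {v : Vec ℕ n} → Descent j d v → v ∈ descents j d n
  ∈-descents⁺ d       [] = here refl
  ∈-descents⁺ zero    (z≤n ∷ D) = ∈-map⁺ _ (∈-descents⁺ zero D)
  ∈-descents⁺ {j} (suc d) (_∷_ {e = e} e≤1+d D) with e ℕ.≟ suc d
  ... | yes refl  = ∈-++⁺ˡ (∈-map⁺ _ (∈-descents⁺ (suc d) D))
  ... | no  e≢1+d = ∈-++⁺ʳ (map (j + suc d ∷_) (descents (suc j) (suc d) _))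
                           (∈-descents⁺ d (s≤s⁻¹ (≤∧≢⇒< e≤1+d e≢1+d) ∷ D))

  ∈-profiles⁻ : ∀ {p n} {v : Vec ℕ n} → v ∈ profiles p n → Profile p v
  ∈-profiles⁻ {p} {zero}  (here refl) = []
  ∈-profiles⁻ {p} {suc n} {_ ∷ _} v∈ with ∈-++⁻ (map (suc p ∷_) (profiles (suc p) n)) v∈
  ... | inj₁ v∈ˡ with _ , v∈′ , refl ← ∈-map⁻ _ v∈ˡ = up (∈-profiles⁻ v∈′)
  ... | inj₂ v∈ʳ = down (∈-descents⁻ p v∈ʳ)

  ∈-profiles⁺ : ∀ {p n} {v : Vec ℕ n} → Profile p v → v ∈ profiles p n
  ∈-profiles⁺ []     = here refl
  ∈-profiles⁺ (up P) = ∈-++⁺ˡ (∈-map⁺ _ (∈-profiles⁺ P))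
  ∈-profiles⁺ {p} {suc n} (down D) =
    ∈-++⁺ʳ (map (suc p ∷_) (profiles (suc p) n)) (∈-descents⁺ p D)

  descent-head : ∀ {n j d x} {v : Vec ℕ n} → Descent j d (x ∷ v) → x ≤ j + d
  descent-head {j = j} (e≤d ∷ _) = +-monoʳ-≤ j e≤d

  descents-unique : ∀ j d n → Unique (descents j d n)
  descents-unique j d       zero    = [] ∷ []
  descents-unique j zero    (suc n) = Unique.map⁺ ∷-injectiveʳ (descents-unique (suc j) 0 n)
  descents-unique j (suc d) (suc n) =
    Unique.++⁺ (Unique.map⁺ ∷-injectiveʳ (descents-unique (suc j) (suc d) n)) (descents-unique j d (suc n))
      λ (v∈ˡ , v∈ʳ) → disjoint v∈ˡ v∈ʳ
    where
    -- The two sublists differ in the first entry: `j + suc d` on the left, at most `j + d` on the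
    -- right.
    disjoint : ∀ {v} → v ∈ map (j + suc d ∷_) (descents (suc j) (suc d) n) → ¬ v ∈ descents j d (suc n)
    disjoint v∈ˡ v∈ʳ with _ , _ , refl ← ∈-map⁻ _ v∈ˡ =
      1+n≰n (+-cancelˡ-≤ j _ _ (descent-head (∈-descents⁻ d v∈ʳ)))

  profiles-unique : ∀ p n → Unique (profiles p n)
  profiles-unique p zero    = [] ∷ []
  profiles-unique p (suc n) =
    Unique.++⁺ (Unique.map⁺ ∷-injectiveʳ (profiles-unique (suc p) n)) (descents-unique 0 p (suc n))
      λ (v∈ˡ , v∈ʳ) → disjoint v∈ˡ v∈ʳ
    where
    disjoint : ∀ {v} → v ∈ map (suc p ∷_) (profiles (suc p) n) → ¬ v ∈ descents 0 p (suc n)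
    disjoint v∈ˡ v∈ʳ with _ , _ , refl ← ∈-map⁻ _ v∈ˡ = 1+n≰n (descent-head (∈-descents⁻ p v∈ʳ))

  𝒜↭ : ∀ n → 𝒜 (suc n) ↭ map (0 ∷_) (profiles 0 n)
  𝒜↭ n = unique⇒↭ (𝒜-unique (suc n)) (Unique.map⁺ ∷-injectiveʳ (profiles-unique 0 n)) (mk⇔ forth back)
    where
    forth : ∀ {a} → a ∈ 𝒜 (suc n) → a ∈ map (0 ∷_) (profiles 0 n)
    forth {x ∷ v} a∈ with area , ab ← to (∈𝒜⇔ (x ∷ v)) a∈ with refl , c ← isAreaSequence⁻ area =
      ∈-map⁺ _ (∈-profiles⁺ (profile⁺ c (isAbelian⁻ c ab)))
    back : ∀ {a} → a ∈ map (0 ∷_) (profiles 0 n) → a ∈ 𝒜 (suc n)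
    back a∈ with v , v∈ , refl ← ∈-map⁻ _ a∈ =
      from (∈𝒜⇔ (0 ∷ v)) (isAreaSequence⁺ (profile⇒climbs P) , isAbelian⁺ (profile⇒abelian P))
      where P = ∈-profiles⁻ v∈

  -- Counting peak-cliques by their right ends.

  -- For an entry `x` followed by `v`, this says that `x` stands at the last position of its value
  -- of `b`: `b` increases strictly at the next position exactly when the entries do not rise.
  Ends : ∀ {n} → ℕ → Vec ℕ n → Set
  Ends x []      = ⊤
  Ends x (y ∷ _) = y ≤ x

  ends? : ∀ {n} x (v : Vec ℕ n) → Dec (Ends x v)
  ends? x []      = yes tt
  ends? x (y ∷ _) = y ≤? x

  -- The entries of v have the positions p, p + 1, …; the entry at j ends a
  -- peak-clique, and that clique contains the vertex k.
  Covers : ∀ {n} → ℕ → ℕ → Vec ℕ n → Fin n → Set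
  Covers k p (x ∷ v) zero    = k ≤ p × p ≤ k + x × Ends x v
  Covers k p (x ∷ v) (suc j) = Covers k (suc p) v j

  covers? : ∀ {n} k p (v : Vec ℕ n) j → Dec (Covers k p v j)
  covers? k p (x ∷ v) zero    = (k ≤? p) ×-dec (p ≤? k + x) ×-dec ends? x v
  covers? k p (x ∷ v) (suc j) = covers? k (suc p) v j

  -- Equivalently, the left end of the longest clique ending at j moves on at j + 1.
  NonRising : ∀ {n} → Vec ℕ n → Fin n → Set
  NonRising a j = ∀ j⁺ → label j⁺ ≡ suc (label j) → lookup a j⁺ ≤ lookup a j

  covers⁺ : ∀ {n k} p (v : Vec ℕ n) j → k ≤ p + toℕ j → p + toℕ j ≤ k + lookup v j →
            NonRising v j → Covers k p v j
  covers⁺ {k = k} p (x ∷ v) zero k≤ ≤k s =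
    subst (k ≤_) (+-identityʳ p) k≤ , subst (_≤ k + x) (+-identityʳ p) ≤k , last v s
    where
    last : ∀ {n} (v : Vec ℕ n) → NonRising (x ∷ v) zero → Ends x v
    last []      _ = tt
    last (y ∷ v) s = s (suc zero) refl
  covers⁺ {k = k} p (x ∷ v) (suc j) k≤ ≤k s =
    covers⁺ (suc p) v j (subst (k ≤_) (+-suc p (toℕ j)) k≤)
      (subst (_≤ k + lookup v j) (+-suc p (toℕ j)) ≤k)
      λ j⁺ eq → s (suc j⁺) (cong suc eq)

  covers⁻ : ∀ {n k} p (v : Vec ℕ n) j → Covers k p v j →
            k ≤ p + toℕ j × p + toℕ j ≤ k + lookup v j × NonRising v j
  covers⁻ {k = k} p (x ∷ v) zero (k≤p , p≤ , l) =
    subst (k ≤_) (sym (+-identityʳ p)) k≤p , subst (_≤ k + x) (sym (+-identityʳ p)) p≤ , nonRising v l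
    where
    nonRising : ∀ {n} (v : Vec ℕ n) → Ends x v → NonRising (x ∷ v) zero
    nonRising (y ∷ v) y≤x (suc zero) _ = y≤x
  covers⁻ {k = k} p (x ∷ v) (suc j) c with k≤ , ≤k , s ← covers⁻ (suc p) v j c =
    subst (k ≤_) (sym (+-suc p (toℕ j))) k≤ ,
    subst (_≤ k + lookup v j) (sym (+-suc p (toℕ j))) ≤k ,
    λ { (suc j⁺) eq → s j⁺ (suc-injective eq) }

  indicator : ∀ {P : Set} → Dec P → ℕ
  indicator P? = if does P? then 1 else 0

  -- Each position is the right end of at most one peak-clique, so the count over pairs becomes a
  -- sum along the sequence, open to induction on `v`.
  nest : ∀ {n} → ℕ → ℕ → Vec ℕ n → ℕ
  nest k p []      = 0
  nest k p (x ∷ v) = indicator (covers? k p (x ∷ v) zero) + nest k (suc p) v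

  -- An arbitrary `f` is allowed because the tail of `tabulate id` is `tabulate suc`; the lemma is
  -- applied with `f = id`.
  nest-count : ∀ {n k p} (v : Vec ℕ n) {A : Set} {P : A → Set} (P? : ∀ x → Dec (P x)) (f : Fin n → A) →
               (∀ j → P (f j) ⇔ Covers k p v j) → length (filter P? (tabulate f)) ≡ nest k p v
  nest-count [] P? f same = refl
  nest-count {k = k} {p} (x ∷ v) P? f same = begin
    length (filter P? (tabulate f))
      ≡⟨ length-filter-∷ ⟩
    indicator (P? (f zero)) + length (filter P? (tabulate (f ∘ suc)))
      ≡⟨ cong₂ (λ b m → (if b then 1 else 0) + m)
           (does-⇔ (same zero) (P? (f zero)) (covers? k p (x ∷ v) zero))
           (nest-count v P? (f ∘ suc) (same ∘ suc)) ⟩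
    indicator (covers? k p (x ∷ v) zero) + nest k (suc p) v
      ∎
    where
    open ≡-Reasoning
    length-filter-∷ : length (filter P? (tabulate f)) ≡
                      indicator (P? (f zero)) + length (filter P? (tabulate (f ∘ suc)))
    length-filter-∷ with does (P? (f zero))
    ... | true  = refl
    ... | false = refl

  -- Peak-edges expressed through `b`.

  -- That `i - 1` and `j` are not adjacent makes `i` the left end `b_j` of the longest clique ending
  -- at `j`; that `i` and `j + 1` are not adjacent makes `b` increase after `j`. An isolated vertex
  -- is the case `a_i = 0`.
  peakEdge⁻ : ∀ {n} {v : Vec ℕ n} → Climbs 0 v → ∀ i j → PeakEdge (0 ∷ v) i j →
              toℕ i + lookup (0 ∷ v) j ≡ toℕ j × NonRising (0 ∷ v) j
  peakEdge⁻ c i j (inj₂ (i<j , adj , ¬adj⁺ , ¬adj⁻)) =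
    ≤-antisym (i+a≤j i refl) (adjacent⁻ a i<j′ adj) , λ j⁺ eq → ≮⇒≥ λ a<a⁺ → ¬adj⁺ j⁺ eq (inj₁ (edge⁺ a
      (<-trans i<j′ (≤-reflexive (sym (suc-injective eq)))) (begin
      toℕ j⁺                     ≡⟨ suc-injective eq ⟩
      suc (toℕ j)                ≤⟨ s≤s (adjacent⁻ a i<j′ adj) ⟩
      suc (toℕ i + lookup a j)   ≡⟨ +-suc (toℕ i) _ ⟨
      toℕ i + suc (lookup a j)   ≤⟨ +-monoʳ-≤ (toℕ i) a<a⁺ ⟩
      toℕ i + lookup a j⁺        ∎)))
    where
    open ≤-Reasoning
    a    = 0 ∷ _
    i<j′ = s≤s⁻¹ i<j
    i+a≤j : ∀ i′ → i′ ≡ i → toℕ i + lookup a j ≤ toℕ j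
    -- Vertex 0 has no left neighbour; the bound `a_j ≤ j` takes the place of the missing condition.
    i+a≤j zero     refl = lookup≤toℕ c j
    i+a≤j (suc i′) refl = ≰⇒> λ j≤ → ¬adj⁻ (inject₁ i′) (cong (λ h → suc (suc h)) (sym (toℕ-inject₁ i′)))
      (inj₁ (edge⁺ a (subst (_< toℕ j) (sym (toℕ-inject₁ i′)) (<-trans ≤-refl i<j′))
                     (subst (λ h → toℕ j ≤ h + lookup a j) (sym (toℕ-inject₁ i′)) j≤)))
  peakEdge⁻ c i .i (inj₁ (refl , isolated)) =
    trans (cong (toℕ i +_) (a≡0 i refl)) (+-identityʳ (toℕ i)) ,
    λ j⁺ eq → ≤-trans (≮⇒≥ λ a⁺>0 → isolated j⁺ (inj₁ (edge⁺ a (≤-reflexive (sym (suc-injective eq)))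
      (≤-trans (≤-reflexive (trans (suc-injective eq) (+-comm 1 (toℕ i)))) (+-monoʳ-≤ (toℕ i) a⁺>0))))) z≤n
    where
    a = 0 ∷ _
    a≡0 : ∀ i′ → i′ ≡ i → lookup a i ≡ 0
    a≡0 zero     refl = refl
    a≡0 (suc i′) refl = n<1⇒n≡0 (≰⇒> λ a>0 → isolated (inject₁ i′) (inj₂ (edge⁺ a
      (≤-reflexive (cong suc (toℕ-inject₁ i′)))
      (subst (λ h → suc (toℕ i′) ≤ h + lookup a (suc i′)) (sym (toℕ-inject₁ i′))
         (≤-trans (≤-reflexive (+-comm 1 (toℕ i′))) (+-monoʳ-≤ (toℕ i′) a>0))))))

  peakEdge⁺ : ∀ {n} {v : Vec ℕ n} → Climbs 0 v → ∀ i j → toℕ i + lookup (0 ∷ v) j ≡ toℕ j →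
              NonRising (0 ∷ v) j → PeakEdge (0 ∷ v) i j
  peakEdge⁺ {n} {v} c i j i+a≡j s with toℕ i ℕ.≟ toℕ j
  ... | no i≢j = inj₂ (s≤s i<j , inj₁ (edge⁺ a i<j (≤-reflexive (sym i+a≡j))) ,
    (λ j⁺ eq adj → 1+n≰n (begin
      suc (toℕ j)           ≡⟨ suc-injective eq ⟨
      toℕ j⁺                ≤⟨ adjacent⁻ a (<-trans i<j (≤-reflexive (sym (suc-injective eq)))) adj ⟩
      toℕ i + lookup a j⁺   ≤⟨ +-monoʳ-≤ (toℕ i) (s j⁺ eq) ⟩
      toℕ i + lookup a j    ≡⟨ i+a≡j ⟩
      toℕ j                 ∎)) ,
    λ i⁻ eq adj → 1+n≰n (begin
      suc (toℕ i⁻ + lookup a j)  ≡⟨ cong (_+ lookup a j) (suc-injective eq) ⟨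
      toℕ i + lookup a j         ≡⟨ i+a≡j ⟩
      toℕ j                      ≤⟨ adjacent⁻ a (<-trans (≤-reflexive (sym (suc-injective eq))) i<j) adj ⟩
      toℕ i⁻ + lookup a j        ∎))
    where
    open ≤-Reasoning
    a = 0 ∷ v
    i<j : toℕ i < toℕ j
    i<j = ≤∧≢⇒< (≤-trans (m≤m+n (toℕ i) _) (≤-reflexive i+a≡j)) i≢j
  ... | yes i≡j with refl ← toℕ-injective i≡j = inj₁ (refl , isolated)
    where
    open ≤-Reasoning
    a = 0 ∷ v
    a≡0 : lookup a i ≡ 0
    a≡0 = +-cancelˡ-≡ (toℕ i) _ _ (trans i+a≡j (sym (+-identityʳ (toℕ i))))
    isolated : Isolated a i
    isolated m (inj₂ e) with m<i , i≤ ← edge⁻ a e = <⇒≱ m<i (begin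
      toℕ i                ≤⟨ i≤ ⟩
      toℕ m + lookup a i   ≡⟨ cong (toℕ m +_) a≡0 ⟩
      toℕ m + 0            ≡⟨ +-identityʳ _ ⟩
      toℕ m                ∎)
    -- A later neighbour `m` of `i` would have `b_m ≤ i`. But `s` forces the entry at `i + 1` to be
    -- 0, so `b` is `i + 1` there and at least `i + 1` at `m`.
    isolated m (inj₁ e) with i<m , m≤ ← edge⁻ a e = 1+n≰n (begin
      suc (toℕ m)               ≤⟨ s≤s m≤ ⟩
      suc (toℕ i) + lookup a m  ≡⟨ cong (_+ lookup a m) i⁺≡ ⟨
      toℕ i⁺ + lookup a m       ≤⟨ climbs-lookup c (subst (_≤ toℕ m) (sym i⁺≡) i<m) ⟩
      toℕ m + lookup a i⁺       ≤⟨ +-monoʳ-≤ (toℕ m) (s i⁺ (cong suc i⁺≡)) ⟩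
      toℕ m + lookup a i        ≡⟨ cong (toℕ m +_) a≡0 ⟩
      toℕ m + 0                 ≡⟨ +-identityʳ _ ⟩
      toℕ m                     ∎)
      where
      1+i<1+n = <-≤-trans (s≤s i<m) (toℕ<n m)
      i⁺  = fromℕ< 1+i<1+n
      i⁺≡ = toℕ-fromℕ< 1+i<1+n

  -- The right end `j` of a peak-clique determines its left end `j - a_j`. Hence the pairs counted
  -- by `peakNesting` are, up to order, the images under `clique` of the right ends counted by
  -- `nest`.
  peakNesting≡nest : ∀ {n} {v : Vec ℕ n} → Climbs 0 v →
                     ∀ k → peakNesting (0 ∷ v) k ≡ nest (toℕ k) 0 (0 ∷ v)
  peakNesting≡nest {n} {v} c k = begin
    peakNesting a k                                       ≡⟨ ↭-length (unique⇒↭ pairs! ends! (mk⇔ forth back)) ⟩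
    length (map clique (filter covers (allFin (suc n))))  ≡⟨ length-map clique (filter covers (allFin (suc n))) ⟩
    length (filter covers (allFin (suc n)))               ≡⟨ nest-count a covers id (λ j → mk⇔ id id) ⟩
    nest (toℕ k) 0 a                                      ∎
    where
    open ≡-Reasoning
    a = 0 ∷ v
    covers = covers? (toℕ k) 0 a

    start : Fin (suc n) → Fin (suc n)
    start j = fromℕ< (≤-<-trans (m∸n≤m (toℕ j) (lookup a j)) (toℕ<n j))

    clique : Fin (suc n) → Fin (suc n) × Fin (suc n)
    clique j = start j , j

    toℕ-start : ∀ j → toℕ (start j) + lookup a j ≡ toℕ j
    toℕ-start j = trans (cong (_+ lookup a j) (toℕ-fromℕ< _)) (m∸n+n≡m (lookup≤toℕ c j))

    peakClique? = λ ((i , j) : Fin (suc n) × Fin (suc n)) → peakEdge? a i j ×-dec k ∈[ i , j ]?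
    pairs = cartesianProduct (allFin (suc n)) (allFin (suc n))

    pairs! : Unique (filter peakClique? pairs)
    pairs! = Unique.filter⁺ peakClique?
      (Unique.cartesianProduct⁺ (Unique.allFin⁺ (suc n)) (Unique.allFin⁺ (suc n)))

    ends! : Unique (map clique (filter covers (allFin (suc n))))
    ends! = Unique.map⁺ ,-injectiveʳ (Unique.filter⁺ covers (Unique.allFin⁺ (suc n)))

    forth : ∀ {ij} → ij ∈ filter peakClique? pairs → ij ∈ map clique (filter covers (allFin (suc n)))
    forth {i , j} ij∈ with _ , peak , i≤k , k≤j ← ∈-filter⁻ peakClique? {xs = pairs} ij∈
      with i+a≡j , s ← peakEdge⁻ c i j peak =
      subst (λ h → (h , j) ∈ map clique (filter covers (allFin (suc n)))) start≡i
        (∈-map⁺ clique (∈-filter⁺ covers (∈-allFin j) (covers⁺ 0 a j (s≤s⁻¹ k≤j) j≤k+a s)))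
      where
      start≡i : start j ≡ i
      start≡i = toℕ-injective (+-cancelʳ-≡ (lookup a j) _ _ (trans (toℕ-start j) (sym i+a≡j)))
      j≤k+a : toℕ j ≤ toℕ k + lookup a j
      j≤k+a = ≤-trans (≤-reflexive (sym i+a≡j)) (+-monoˡ-≤ (lookup a j) (s≤s⁻¹ i≤k))

    back : ∀ {ij} → ij ∈ map clique (filter covers (allFin (suc n))) → ij ∈ filter peakClique? pairs
    back ij∈ with j , j∈ , refl ← ∈-map⁻ clique ij∈
      with _ , cov ← ∈-filter⁻ covers {xs = allFin (suc n)} j∈
      with k≤j , j≤k+a , s ← covers⁻ 0 a j cov =
      ∈-filter⁺ peakClique? (∈-cartesianProduct⁺ (∈-allFin (start j)) (∈-allFin j))
        (peakEdge⁺ c (start j) j (toℕ-start j) s ,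
         s≤s (+-cancelʳ-≤ (lookup a j) _ _ (≤-trans (≤-reflexive (toℕ-start j)) j≤k+a)) , s≤s k≤j)

  -- The vertex of maximal peak-nesting.

  indicator-true : ∀ {P : Set} (P? : Dec P) → P → indicator P? ≡ 1
  indicator-true P? p = cong (if_then 1 else 0) (dec-true P? p)

  indicator-false : ∀ {P : Set} (P? : Dec P) → ¬ P → indicator P? ≡ 0
  indicator-false P? ¬p = cong (if_then 1 else 0) (dec-false P? ¬p)

  indicator-mono : ∀ {P Q : Set} (P? : Dec P) (Q? : Dec Q) → (P → Q) → indicator P? ≤ indicator Q?
  indicator-mono (no  _) _  _   = z≤n
  indicator-mono (yes p) Q? P⊆Q = ≤-reflexive (sym (indicator-true Q? (P⊆Q p)))

  indicator≤1 : ∀ {P : Set} (P? : Dec P) → indicator P? ≤ 1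
  indicator≤1 (no  _) = z≤n
  indicator≤1 (yes _) = ≤-refl

  -- All right ends in question lie at or beyond `k′`, so a vertex moving from `k` towards them
  -- leaves no clique.
  nest-mono : ∀ {n k k′ p} (v : Vec ℕ n) → k ≤ k′ → k′ ≤ p → nest k p v ≤ nest k′ p v
  nest-mono [] _ _ = z≤n
  nest-mono {k = k} {k′} {p} (x ∷ v) k≤k′ k′≤p = +-mono-≤
    (indicator-mono (covers? k p (x ∷ v) zero) (covers? k′ p (x ∷ v) zero)
      λ (_ , p≤ , end) → k′≤p , ≤-trans p≤ (+-monoˡ-≤ x k≤k′) , end)
    (nest-mono v k≤k′ (m≤n⇒m≤1+n k′≤p))

  nest-skip : ∀ {n k p x y} (v : Vec ℕ n) → x < y → nest k p (x ∷ y ∷ v) ≡ nest k (suc p) (y ∷ v)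
  nest-skip {k = k} {p} {x} {y} v x<y =
    cong (_+ nest k (suc p) (y ∷ v))
      (indicator-false (covers? k p (x ∷ y ∷ v) zero) λ (_ , _ , y≤x) → <⇒≱ x<y y≤x)

  -- All these entries share one value of `b`, so only the last of them ends a peak-clique.
  nest-flat : ∀ {n j} k p {v : Vec ℕ n} → Descent j 0 v → nest k p v ≤ 1
  nest-flat k p [] = z≤n
  nest-flat {j = j} k p (z≤n ∷ []) =
    ≤-trans (≤-reflexive (+-identityʳ _)) (indicator≤1 (covers? k p (j + 0 ∷ []) zero))
  nest-flat k p (z≤n ∷ D@(_∷_ {v = v} z≤n _)) =
    ≤-trans (≤-reflexive (nest-skip {k = k} {p} v ≤-refl)) (nest-flat k (suc p) D)

  -- A clique ending at an entry with `e > 0` starts at `p + 1 - e ≤ p` and ends beyond `p`, so it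
  -- contains `p`. The entries with `e = 0` have the common left end `p + 1` and yield at most one
  -- further clique.
  nest-descent : ∀ {n j d} k p {v : Vec ℕ n} → Descent j d v →
                 nest k (suc (j + p)) v ≤ suc (nest p (suc (j + p)) v)
  nest-descent k p [] = z≤n
  nest-descent {j = j} k p (_∷_ {e = zero} _ D) = ≤-trans (nest-flat k (suc (j + p)) (z≤n ∷ D)) (s≤s z≤n)
  nest-descent {j = j} k p (_∷_ {e = suc e} {v} _ D) = ≤-trans
    (+-mono-≤ (indicator-mono (covers? k q (x ∷ v) zero) (covers? p q (x ∷ v) zero)
                 λ (_ , _ , end) → m≤n⇒m≤1+n (m≤n+m p j) , q≤p+x , end)
              (nest-descent k p D))
    (≤-reflexive (+-suc _ _))
    where
    q = suc (j + p)
    x = j + suc e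
    q≤p+x : q ≤ p + x
    q≤p+x = begin
      suc (j + p)       ≡⟨ cong suc (+-comm j p) ⟩
      suc (p + j)       ≡⟨ +-suc p j ⟨
      p + suc j         ≤⟨ +-monoʳ-≤ p (s≤s (m≤m+n j e)) ⟩
      p + suc (j + e)   ≡⟨ cong (p +_) (+-suc j e) ⟨
      p + x             ∎
      where open ≤-Reasoning

  -- This is the peak-nesting of the last vertex of the initial run; the leading 1 counts the
  -- peak-clique formed by the run itself.
  nesting : ∀ {n} → ℕ → Vec ℕ n → ℕ
  nesting p []      = 1
  nesting p (x ∷ v) = if does (x ℕ.≟ suc p) then nesting (suc p) v else suc (nest p (suc p) (x ∷ v))

  nesting-up : ∀ {n} p (v : Vec ℕ n) → nesting p (suc p ∷ v) ≡ nesting (suc p) v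
  nesting-up p v rewrite dec-true (suc p ℕ.≟ suc p) refl = refl

  nesting-down : ∀ {n p x} (v : Vec ℕ n) → x ≤ p → nesting p (x ∷ v) ≡ suc (nest p (suc p) (x ∷ v))
  nesting-down {p = p} {x} v x≤p rewrite dec-false (x ℕ.≟ suc p) (λ { refl → 1+n≰n x≤p }) = refl

  nest≤nesting : ∀ {n p} k {v : Vec ℕ n} → Profile p v → nest k p (p ∷ v) ≤ nesting p v
  nest≤nesting {p = p} k [] = ≤-trans (≤-reflexive (+-identityʳ _)) (indicator≤1 (covers? k p (p ∷ []) zero))
  nest≤nesting {p = p} k (up {v = v} P) = begin
    nest k p (p ∷ suc p ∷ v)      ≡⟨ nest-skip {k = k} {p} v ≤-refl ⟩
    nest k (suc p) (suc p ∷ v)    ≤⟨ nest≤nesting k P ⟩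
    nesting (suc p) v             ≡⟨ nesting-up p v ⟨
    nesting p (suc p ∷ v)         ∎
    where open ≤-Reasoning
  nest≤nesting {p = p} k (down {x = x} {v} D) =
    ≤-trans bound (≤-reflexive (sym (nesting-down v (descent-head D))))
    where
    bound : nest k p (p ∷ x ∷ v) ≤ suc (nest p (suc p) (x ∷ v))
    -- For `k ≤ p`, moving the vertex to `p` loses nothing. For `k > p`, the clique of the run does
    -- not contain `k`, and this makes up for the one clique that may contain `k` but not `p`.
    bound with k ≤? p
    ... | yes k≤p = +-mono-≤ (indicator≤1 (covers? k p (p ∷ x ∷ v) zero)) (nest-mono (x ∷ v) k≤p (n≤1+n p))
    ... | no  k≰p = ≤-trans
      (≤-reflexive (cong (_+ nest k (suc p) (x ∷ v))
        (indicator-false (covers? k p (p ∷ x ∷ v) zero) (k≰p ∘ proj₁))))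
      (nest-descent k p D)

  -- The witness is the last vertex of the run, counted from `p`.
  nest≡nesting : ∀ {n p} {v : Vec ℕ n} → Profile p v →
                 ∃[ k ] nest (p + toℕ {suc n} k) p (p ∷ v) ≡ nesting p v
  nest≡nesting {p = p} [] = zero , cong (_+ 0) (indicator-true (covers? (p + 0) p (p ∷ []) zero)
    (≤-reflexive (+-identityʳ p) , m≤n+m p (p + 0) , _))
  nest≡nesting {p = p} (up {v = v} P) with k , eq ← nest≡nesting P = suc k , (begin
    nest (p + suc (toℕ k)) p (p ∷ suc p ∷ v)     ≡⟨ nest-skip {k = p + suc (toℕ k)} {p} v ≤-refl ⟩
    nest (p + suc (toℕ k)) (suc p) (suc p ∷ v)   ≡⟨ cong (λ k′ → nest k′ (suc p) (suc p ∷ v)) (+-suc p (toℕ k)) ⟩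
    nest (suc p + toℕ k) (suc p) (suc p ∷ v)     ≡⟨ eq ⟩
    nesting (suc p) v                            ≡⟨ nesting-up p v ⟨
    nesting p (suc p ∷ v)                        ∎)
    where open ≡-Reasoning
  nest≡nesting {p = p} (down {x = x} {v} D) = zero , (begin
    nest (p + 0) p (p ∷ x ∷ v)         ≡⟨ cong (λ k → nest k p (p ∷ x ∷ v)) (+-identityʳ p) ⟩
    nest p p (p ∷ x ∷ v)               ≡⟨ cong (_+ nest p (suc p) (x ∷ v))
                                            (indicator-true (covers? p p (p ∷ x ∷ v) zero)
                                              (≤-refl , m≤m+n p p , descent-head D)) ⟩
    suc (nest p (suc p) (x ∷ v))       ≡⟨ nesting-down v (descent-head D) ⟨
    nesting p (x ∷ v)                  ∎)
    where open ≡-Reasoning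

  max-map : ∀ {A : Set} (f : A → ℕ) {xs : List A} {x m} → x ∈ xs → f x ≡ m → (∀ y → f y ≤ m) →
            max 0 (map f xs) ≡ m
  max-map f {xs} x∈xs refl f≤m =
    max≈v⁺ (∈-map⁺ f x∈xs) (All.map⁺ (All.universal f≤m xs)) z≤n

  pnest≡nesting : ∀ {n} {v : Vec ℕ n} → Profile 0 v → pnest (0 ∷ v) ≡ nesting 0 v
  pnest≡nesting {n} {v} P =
    max-map (peakNesting (0 ∷ v)) {allFin (suc n)} {proj₁ (nest≡nesting P)} (∈-allFin _) attained bounded
    where
    c = profile⇒climbs P
    attained : peakNesting (0 ∷ v) (proj₁ (nest≡nesting P)) ≡ nesting 0 v
    attained = trans (peakNesting≡nest c _) (proj₂ (nest≡nesting P))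
    bounded : ∀ i → peakNesting (0 ∷ v) i ≤ nesting 0 v
    bounded i = ≤-trans (≤-reflexive (peakNesting≡nest c i)) (nest≤nesting (toℕ i) P)

module Sums {c ℓ} (R : CommutativeRing c ℓ) where
  open CommutativeRing R hiding (zero)
  open GeneratingFunction R
  open import Algebra.Properties.CommutativeSemigroup +-commutativeSemigroup using (interchange; x∙yz≈y∙xz)
  open import Algebra.Properties.CommutativeSemigroup *-commutativeSemigroup
    using () renaming (interchange to *-interchange)
  open import Algebra.Properties.Ring ring using (-‿distribˡ-*; -‿distribʳ-*; -‿involutive; -‿+-comm)
  open import Algebra.Properties.Semiring.Mult semiring using (×-homo-+; ×-comm-*; ×-congˡ)
  open import Relation.Binary.Reasoning.Setoid setoid

  -- Finite sums.

  ∑-↭ : ∀ {A : Set} {xs ys : List A} (f : A → Carrier) → xs ↭ ys → ∑-syntax xs f ≈ ∑-syntax ys f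
  ∑-↭ f ↭.refl          = refl
  ∑-↭ f (↭.prep x p)    = +-congˡ (∑-↭ f p)
  ∑-↭ f (↭.swap x y p)  = trans (x∙yz≈y∙xz (f x) (f y) _) (+-congˡ (+-congˡ (∑-↭ f p)))
  ∑-↭ f (↭.trans p q)   = trans (∑-↭ f p) (∑-↭ f q)

  ∑-cong : ∀ {A : Set} (xs : List A) {f g : A → Carrier} → (∀ {x} → x ∈ xs → f x ≈ g x) →
           ∑-syntax xs f ≈ ∑-syntax xs g
  ∑-cong []       _   = refl
  ∑-cong (x ∷ xs) f≈g = +-cong (f≈g (here ≡.refl)) (∑-cong xs (f≈g ∘ there))

  ∑-map : ∀ {A B : Set} (g : A → B) xs (f : B → Carrier) → ∑-syntax (map g xs) f ≈ ∑-syntax xs (f ∘ g)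
  ∑-map g []       f = refl
  ∑-map g (x ∷ xs) f = +-congˡ (∑-map g xs f)

  ∑-++ : ∀ {A : Set} (xs ys : List A) (f : A → Carrier) →
         ∑-syntax (xs ++ ys) f ≈ ∑-syntax xs f + ∑-syntax ys f
  ∑-++ []       ys f = sym (+-identityˡ _)
  ∑-++ (x ∷ xs) ys f = trans (+-congˡ (∑-++ xs ys f)) (sym (+-assoc _ _ _))

  ∑-*ˡ : ∀ {A : Set} (xs : List A) c (f : A → Carrier) → (∑[ x ← xs ] c * f x) ≈ c * ∑-syntax xs f
  ∑-*ˡ []       c f = sym (zeroʳ c)
  ∑-*ˡ (x ∷ xs) c f = trans (+-congˡ (∑-*ˡ xs c f)) (sym (distribˡ c _ _))

  ∑-+ : ∀ {A : Set} (xs : List A) (f g : A → Carrier) →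
        (∑[ x ← xs ] f x + g x) ≈ ∑-syntax xs f + ∑-syntax xs g
  ∑-+ []       f g = sym (+-identityˡ 0#)
  ∑-+ (x ∷ xs) f g = trans (+-congˡ (∑-+ xs f g)) (interchange _ _ _ _)

  ∑-zero : ∀ {A : Set} (xs : List A) → (∑[ _ ← xs ] 0#) ≈ 0#
  ∑-zero []       = refl
  ∑-zero (_ ∷ xs) = trans (+-identityˡ _) (∑-zero xs)

  ∑-upTo : ∀ n (f : ℕ → Carrier) → ∑-syntax (upTo (suc n)) f ≈ f 0 + ∑-syntax (upTo n) (f ∘ suc)
  ∑-upTo n f = +-congˡ (trans (reflexive (≡.cong (λ is → ∑-syntax is f) (≡.sym (map-upTo suc n))))
                              (∑-map suc (upTo n) f))

  -- Generating functions of descents and profiles.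

  module _ (t : Carrier) where

    -- D d n is the corner-counting sum over the lattice paths with n entries still to
    -- be placed and d levels still to descend; in D′ an entry has just been placed at
    -- the current level, so that leaving this level d > 0 makes a corner.
    D  : ℕ → ℕ → Carrier
    D′ : ℕ → ℕ → Carrier

    D d       zero    = 1#
    D zero    (suc n) = D′ zero n
    D (suc d) (suc n) = D′ (suc d) n + D d (suc n)

    D′ zero    n       = D zero n
    D′ (suc d) zero    = t
    D′ (suc d) (suc n) = D′ (suc d) n + t * D d (suc n)

    -- An entry ends a peak-clique exactly when the path leaves its level for a later entry or stops
    -- there, and the clique contains `p` exactly when that level is positive. So the corners of the
    -- path carry the factors `t`.
    ∑-descents  : ∀ j d n p → (∑[ v ← descents j d n ] t ^ nest p (suc (j ℕ.+ p)) v) ≈ D d n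
    ∑-descents′ : ∀ j d n p →
      (∑[ v ← descents (suc j) d n ] t ^ nest p (suc (j ℕ.+ p)) (j ℕ.+ d ∷ v)) ≈ D′ d n

    ∑-descents j d       zero    p = +-identityʳ 1#
    ∑-descents j zero    (suc n) p = trans (∑-map (j ℕ.+ 0 ∷_) (descents (suc j) 0 n) _) (∑-descents′ j 0 n p)
    ∑-descents j (suc d) (suc n) p = begin
      _ ≈⟨ ∑-++ (map (j ℕ.+ suc d ∷_) (descents (suc j) (suc d) n)) (descents j d (suc n)) _ ⟩
      _ ≈⟨ +-cong (trans (∑-map (j ℕ.+ suc d ∷_) (descents (suc j) (suc d) n) _) (∑-descents′ j (suc d) n p))
                  (∑-descents j d (suc n) p) ⟩
      D′ (suc d) n + D d (suc n) ∎

    -- At level 0 the left end is `p + 1`, so `p` is not covered and no factor `t` arises.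
    ∑-descents′ j zero n p = begin
      (∑[ v ← descents (suc j) 0 n ] t ^ nest p q (j ℕ.+ 0 ∷ v))
        ≈⟨ ∑-cong (descents (suc j) 0 n) (λ {v} _ → reflexive (≡.cong (λ m → t ^ (m ℕ.+ nest p (suc q) v))
             (indicator-false (covers? p q (j ℕ.+ 0 ∷ v) zero)
               λ (_ , q≤ , _) → ℕ.1+n≰n (≡.subst (q ℕ.≤_) p+j+0≡j+p q≤)))) ⟩
      (∑[ v ← descents (suc j) 0 n ] t ^ nest p (suc q) v)
        ≈⟨ ∑-descents (suc j) 0 n p ⟩
      D 0 n ∎
      where
      q = suc (j ℕ.+ p)
      p+j+0≡j+p : p ℕ.+ (j ℕ.+ 0) ≡ j ℕ.+ p
      p+j+0≡j+p = ≡.trans (≡.cong (p ℕ.+_) (ℕ.+-identityʳ j)) (ℕ.+-comm p j)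
    ∑-descents′ j (suc d) n p = go n
      where
      q = suc (j ℕ.+ p)
      x = j ℕ.+ suc d

      counted : ∀ {m} (v : Vec ℕ m) → Ends x v → t ^ nest p q (x ∷ v) ≈ t * t ^ nest p (suc q) v
      counted v end = reflexive (≡.cong (λ m → t ^ (m ℕ.+ nest p (suc q) v))
        (indicator-true (covers? p q (x ∷ v) zero) (ℕ.m≤n⇒m≤1+n (ℕ.m≤n+m p j) , q≤p+x , end)))
        where
        q≤p+x : q ℕ.≤ p ℕ.+ x
        q≤p+x = ≡.subst (ℕ._≤ p ℕ.+ x) (≡.trans (ℕ.+-suc p j) (≡.cong suc (ℕ.+-comm p j)))
          (ℕ.+-monoʳ-≤ p (≡.subst (suc j ℕ.≤_) (≡.sym (ℕ.+-suc j d)) (s≤s (ℕ.m≤m+n j d))))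

      go : ∀ n → (∑[ v ← descents (suc j) (suc d) n ] t ^ nest p q (x ∷ v)) ≈ D′ (suc d) n
      go zero = begin
        t ^ nest p q (x ∷ []) + 0#  ≈⟨ +-identityʳ _ ⟩
        t ^ nest p q (x ∷ [])       ≈⟨ counted [] _ ⟩
        t * 1#                      ≈⟨ *-identityʳ t ⟩
        t                           ∎
      -- If the next entry stays on the level, it is `suc x` and the current entry ends no clique.
      -- If it lies lower, it is at most `x` and the current entry contributes `t`.
      go (suc n) = begin
        _ ≈⟨ ∑-++ (map (y ∷_) (descents (suc (suc j)) (suc d) n)) (descents (suc j) d (suc n)) _ ⟩
        _ ≈⟨ +-cong (trans (∑-map (y ∷_) (descents (suc (suc j)) (suc d) n) _) (trans
               (∑-cong (descents (suc (suc j)) (suc d) n)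
                 λ {v} _ → reflexive (≡.cong (t ^_) (nest-skip {k = p} {q} v ℕ.≤-refl)))
               (∑-descents′ (suc j) (suc d) n p)))
             (trans
               (∑-cong (descents (suc j) d (suc n))
                 λ { {z ∷ v} v∈ → counted (z ∷ v)
                     (≡.subst (z ℕ.≤_) (≡.sym (ℕ.+-suc j d)) (descent-head (∈-descents⁻ d v∈))) })
               (trans (∑-*ˡ (descents (suc j) d (suc n)) t _) (*-congˡ (∑-descents (suc j) d (suc n) p)))) ⟩
        D′ (suc d) n + t * D d (suc n) ∎
        where y = suc j ℕ.+ suc d

    -- The sum of g (p + i) (n − i) over i ≤ n.
    diagonal : (ℕ → ℕ → Carrier) → ℕ → ℕ → Carrier
    diagonal g p zero    = g p 0
    diagonal g p (suc n) = diagonal g (suc p) n + g p (suc n)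

    -- The diagonal sums over the length of the rest of the initial run; the factor `t` comes from
    -- the clique of the run.
    ∑-profiles : ∀ p n → (∑[ v ← profiles p n ] t ^ nesting p v) ≈ t * diagonal D p n
    ∑-profiles p zero    = +-identityʳ _
    ∑-profiles p (suc n) = begin
      _ ≈⟨ ∑-++ (map (suc p ∷_) (profiles (suc p) n)) (descents 0 p (suc n)) _ ⟩
      _ ≈⟨ +-cong (trans (∑-map (suc p ∷_) (profiles (suc p) n) _) (trans
             (∑-cong (profiles (suc p) n) λ {v} _ → reflexive (≡.cong (t ^_) (nesting-up p v)))
             (∑-profiles (suc p) n)))
           (trans
             (∑-cong (descents 0 p (suc n))
               λ { {x ∷ v} v∈ → reflexive (≡.cong (t ^_) (nesting-down v (descent-head (∈-descents⁻ p v∈)))) })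
             (trans (∑-*ˡ (descents 0 p (suc n)) t _) (*-congˡ (∑-descents 0 p (suc n) p)))) ⟩
      t * diagonal D (suc p) n + t * D p (suc n)  ≈⟨ distribˡ t _ _ ⟨
      t * (diagonal D (suc p) n + D p (suc n))    ∎

    -- Pascal's recursion along diagonals.

    -- This shift lets D-suc and D′-suc hold without a case distinction on n.
    shifted : ℕ → ℕ → Carrier
    shifted d zero    = 0#
    shifted d (suc n) = D′ d n

    -- The factor `1#` gives this the same shape as `D′-suc`, so that `diagonal-suc` serves both,
    -- with `c` equal to `1#` and to `t`.
    D-suc : ∀ d n → D (suc d) n ≈ shifted (suc d) n + 1# * D d n
    D-suc d zero    = sym (trans (+-identityˡ _) (*-identityˡ 1#))
    D-suc d (suc n) = +-congˡ (sym (*-identityˡ _))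

    D′-suc : ∀ d n → D′ (suc d) n ≈ shifted (suc d) n + t * D d n
    D′-suc d zero    = sym (trans (+-identityˡ _) (*-identityʳ t))
    D′-suc d (suc n) = refl

    diagonal-suc : ∀ c g → (∀ d n → g (suc d) n ≈ shifted (suc d) n + c * D d n) →
                   ∀ p n → diagonal g (suc p) n ≈ diagonal shifted (suc p) n + c * diagonal D p n
    diagonal-suc c g step p zero    = step p 0
    diagonal-suc c g step p (suc n) = begin
      diagonal g (suc (suc p)) n + g (suc p) (suc n)
        ≈⟨ +-cong (diagonal-suc c g step (suc p) n) (step p (suc n)) ⟩
      (diagonal shifted (suc (suc p)) n + c * diagonal D (suc p) n) + (shifted (suc p) (suc n) + c * D p (suc n))
        ≈⟨ interchange _ _ _ _ ⟩
      diagonal shifted (suc p) (suc n) + (c * diagonal D (suc p) n + c * D p (suc n))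
        ≈⟨ +-congˡ (distribˡ c _ _) ⟨
      diagonal shifted (suc p) (suc n) + c * diagonal D p (suc n) ∎

    -- The longer diagonal has one extra term, a value of `shifted` at `0`, which is `0#`.
    diagonal-shifted : ∀ p n → diagonal shifted p (suc n) ≈ diagonal D′ p n
    diagonal-shifted p zero    = +-identityˡ _
    diagonal-shifted p (suc n) = +-congʳ (diagonal-shifted (suc p) n)

    -- If `s * s ≈ t`, these are the parts of `(1# + s) ^ n` without and with a factor `s`:
    -- multiplication by `1 + s` sends `e + s o` to `(e + t o) + s (e + o)`.
    odd even : ℕ → Carrier
    odd  zero    = 0#
    odd  (suc n) = even n + odd n
    even zero    = 1#
    even (suc n) = even n + t * odd n

    diagonal-D  : ∀ n → diagonal D  0 n ≈ odd  (suc n)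
    diagonal-D′ : ∀ n → diagonal D′ 0 n ≈ even (suc n)

    -- Both `D 0 (suc n)` and `D′ 0 (suc n)` reduce to `D′ 0 n`. This is `shifted 0 (suc n)`,
    -- exactly the term that completes the diagonal starting at 1 to the one starting at 0.
    regroup : ∀ n x → (diagonal shifted 1 n + x) + D′ 0 n ≈ even (suc n) + x
    regroup n x = begin
      (diagonal shifted 1 n + x) + D′ 0 n   ≈⟨ +-assoc _ _ _ ⟩
      diagonal shifted 1 n + (x + D′ 0 n)   ≈⟨ +-congˡ (+-comm _ _) ⟩
      diagonal shifted 1 n + (D′ 0 n + x)   ≈⟨ +-assoc _ _ _ ⟨
      (diagonal shifted 1 n + D′ 0 n) + x   ≈⟨ +-congʳ (diagonal-shifted 0 n) ⟩
      diagonal D′ 0 n + x                   ≈⟨ +-congʳ (diagonal-D′ n) ⟩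
      even (suc n) + x                      ∎

    diagonal-D zero    = sym (+-identityʳ 1#)
    diagonal-D (suc n) = begin
      diagonal D 1 n + D′ 0 n
        ≈⟨ +-congʳ (diagonal-suc 1# D D-suc 0 n) ⟩
      (diagonal shifted 1 n + 1# * diagonal D 0 n) + D′ 0 n
        ≈⟨ regroup n _ ⟩
      even (suc n) + 1# * diagonal D 0 n
        ≈⟨ +-congˡ (trans (*-identityˡ _) (diagonal-D n)) ⟩
      even (suc n) + odd (suc n) ∎

    diagonal-D′ zero    = sym (trans (+-congˡ (zeroʳ t)) (+-identityʳ 1#))
    diagonal-D′ (suc n) = begin
      diagonal D′ 1 n + D′ 0 n
        ≈⟨ +-congʳ (diagonal-suc t D′ D′-suc 0 n) ⟩
      (diagonal shifted 1 n + t * diagonal D 0 n) + D′ 0 n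
        ≈⟨ regroup n _ ⟩
      even (suc n) + t * diagonal D 0 n
        ≈⟨ +-congˡ (*-congˡ (diagonal-D n)) ⟩
      even (suc n) + t * odd (suc n) ∎

    Pnest≈odd : ∀ n → Pnest (suc n) t ≈ t * odd (suc n)
    Pnest≈odd n = begin
      Pnest (suc n) t
        ≈⟨ ∑-↭ _ (𝒜↭ n) ⟩
      (∑[ a ← map (0 ∷_) (profiles 0 n) ] t ^ pnest a)
        ≈⟨ ∑-map (0 ∷_) (profiles 0 n) _ ⟩
      (∑[ v ← profiles 0 n ] t ^ pnest (0 ∷ v))
        ≈⟨ ∑-cong (profiles 0 n) (λ v∈ → reflexive (≡.cong (t ^_) (pnest≡nesting (∈-profiles⁻ v∈)))) ⟩
      (∑[ v ← profiles 0 n ] t ^ nesting 0 v)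
        ≈⟨ ∑-profiles 0 n ⟩
      t * diagonal D 0 n
        ≈⟨ *-congˡ (diagonal-D n) ⟩
      t * odd (suc n) ∎

    -- Binomial sums.

    2*suc : ∀ i → 2 ℕ.* suc i ≡ suc (suc (2 ℕ.* i))
    2*suc i = ≡.cong suc (ℕ.+-suc i (i ℕ.+ 0))

    -- The column is linked to `suc (f i)` by a propositional equality because `2 * suc i` does not
    -- reduce to `suc (suc (2 * i))`.
    ∑-pascal : ∀ n (k : ℕ → ℕ) (is : List ℕ) (f : ℕ → ℕ) (g : ℕ → Carrier) → (∀ i → k i ≡ suc (f i)) →
      (∑[ i ← is ] (suc n C k i) · g i) ≈ (∑[ i ← is ] (n C f i) · g i) + (∑[ i ← is ] (n C k i) · g i)
    ∑-pascal n k is f g k≡1+f = trans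
      (∑-cong is λ {i} _ → begin
        (suc n C k i) · g i                     ≈⟨ ×-congˡ (≡.cong (suc n C_) (k≡1+f i)) ⟩
        (suc n C suc (f i)) · g i               ≈⟨ ×-congˡ (nCk+nC[k+1]≡[n+1]C[k+1] n (f i)) ⟨
        (n C f i ℕ.+ n C suc (f i)) · g i       ≈⟨ ×-homo-+ (g i) (n C f i) _ ⟩
        (n C f i) · g i + (n C suc (f i)) · g i ≈⟨ +-congˡ (×-congˡ (≡.cong (n C_) (k≡1+f i))) ⟨
        (n C f i) · g i + (n C k i) · g i       ∎)
      (∑-+ is _ _)

    -- The number `K` of terms is free because the induction lowers `n` and `K` separately; the
    -- bounds ensure that no nonzero coefficient is cut off.
    ∑-odd  : ∀ n K → n ℕ.≤ 2 ℕ.* K → (∑[ i ← upTo K ] (n C suc (2 ℕ.* i)) · t ^ i) ≈ odd n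
    ∑-even : ∀ n K → n ℕ.< 2 ℕ.* K → (∑[ i ← upTo K ] (n C (2 ℕ.* i)) · t ^ i) ≈ even n

    ∑-odd zero    K _   = ∑-zero (upTo K)
    ∑-odd (suc n) K n<2K = begin
      (∑[ i ← upTo K ] (suc n C suc (2 ℕ.* i)) · t ^ i)
        ≈⟨ ∑-pascal n (λ i → suc (2 ℕ.* i)) (upTo K) (2 ℕ.*_) (t ^_) (λ _ → ≡.refl) ⟩
      (∑[ i ← upTo K ] (n C (2 ℕ.* i)) · t ^ i) + (∑[ i ← upTo K ] (n C suc (2 ℕ.* i)) · t ^ i)
        ≈⟨ +-cong (∑-even n K n<2K) (∑-odd n K (ℕ.<⇒≤ n<2K)) ⟩
      even n + odd n ∎

    ∑-even zero    (suc K) _ = begin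
      _ ≈⟨ ∑-upTo K (λ i → (0 C (2 ℕ.* i)) · t ^ i) ⟩
      (1# + 0#) + _ ≈⟨ +-cong (+-identityʳ 1#) (∑-zero (upTo K)) ⟩
      1# + 0#       ≈⟨ +-identityʳ 1# ⟩
      1#            ∎
    ∑-even (suc n) (suc K) n<2K = begin
      -- Column 0 is split off before Pascal's rule is applied. Its coefficient is 1 in rows `n` and
      -- `suc n` alike, so it later rejoins the sum for row `n`.
      _ ≈⟨ ∑-upTo K (λ i → (suc n C (2 ℕ.* i)) · t ^ i) ⟩
      1 · 1# + (∑[ i ← upTo K ] (suc n C (2 ℕ.* suc i)) · t ^ suc i)
        ≈⟨ +-congˡ (∑-pascal n (λ i → 2 ℕ.* suc i) (upTo K) (λ i → suc (2 ℕ.* i)) (λ i → t ^ suc i) 2*suc) ⟩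
      1 · 1# + ((∑[ i ← upTo K ] (n C suc (2 ℕ.* i)) · t ^ suc i) +
                (∑[ i ← upTo K ] (n C (2 ℕ.* suc i)) · t ^ suc i))
        ≈⟨ x∙yz≈y∙xz _ _ _ ⟩
      (∑[ i ← upTo K ] (n C suc (2 ℕ.* i)) · t ^ suc i) +
      (1 · 1# + (∑[ i ← upTo K ] (n C (2 ℕ.* suc i)) · t ^ suc i))
        ≈⟨ +-cong ∑-t (sym (∑-upTo K (λ i → (n C (2 ℕ.* i)) · t ^ i))) ⟩
      t * (∑[ i ← upTo K ] (n C suc (2 ℕ.* i)) · t ^ i) + (∑[ i ← upTo (suc K) ] (n C (2 ℕ.* i)) · t ^ i)
        ≈⟨ +-cong (*-congˡ (∑-odd n K (s≤s⁻¹ (s≤s⁻¹ (≡.subst (2 ℕ.+ n ℕ.≤_) (2*suc K) n<2K)))))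
                  (∑-even n (suc K) (ℕ.<-trans (ℕ.n<1+n n) n<2K)) ⟩
      t * odd n + even n
        ≈⟨ +-comm _ _ ⟩
      even n + t * odd n ∎
      where
      ∑-t : (∑[ i ← upTo K ] (n C suc (2 ℕ.* i)) · t ^ suc i) ≈
            t * (∑[ i ← upTo K ] (n C suc (2 ℕ.* i)) · t ^ i)
      ∑-t = trans (∑-cong (upTo K) λ {i} _ → sym (×-comm-* (n C suc (2 ℕ.* i)) t (t ^ i))) (∑-*ˡ (upTo K) t _)

    -- The two explicit formulas.

    [1+s]^n : ∀ s n → s * s ≈ t → (1# + s) ^ n ≈ even n + s * odd n
    [1+s]^n s zero    s²≈t = sym (trans (+-congˡ (zeroʳ s)) (+-identityʳ 1#))
    [1+s]^n s (suc n) s²≈t = begin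
      (1# + s) * (1# + s) ^ n
        ≈⟨ *-congˡ ([1+s]^n s n s²≈t) ⟩
      (1# + s) * (even n + s * odd n)
        ≈⟨ distribʳ _ 1# s ⟩
      1# * (even n + s * odd n) + s * (even n + s * odd n)
        ≈⟨ +-cong (*-identityˡ _) (trans (distribˡ s _ _) (+-comm _ _)) ⟩
      (even n + s * odd n) + (s * (s * odd n) + s * even n)
        ≈⟨ +-congˡ (+-congʳ (trans (sym (*-assoc s s _)) (*-congʳ s²≈t))) ⟩
      (even n + s * odd n) + (t * odd n + s * even n)
        ≈⟨ interchange _ _ _ _ ⟩
      (even n + t * odd n) + (s * odd n + s * even n)
        ≈⟨ +-congˡ (trans (+-comm _ _) (sym (distribˡ s _ _))) ⟩
      even (suc n) + s * odd (suc n) ∎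

    -- Both `s` and `- s` are square roots of `t`. In the difference of the two powers the even
    -- parts cancel and `2 s odd n` remains, which `s / 2` turns into `t odd n`.
    odd-closed-form : ∀ n s ½ → s * s ≈ t → (1# + 1#) * ½ ≈ 1# →
                      t * odd n ≈ (s * ½) * ((1# + s) ^ n - (1# - s) ^ n)
    odd-closed-form n s ½ s²≈t 2½≈1 = sym (begin
      (s * ½) * ((1# + s) ^ n - (1# - s) ^ n)
        ≈⟨ *-congˡ (+-cong ([1+s]^n s n s²≈t) (-‿cong ([1+s]^n (- s) n -s²≈t))) ⟩
      (s * ½) * ((even n + s * odd n) - (even n + - s * odd n))
        ≈⟨ *-congˡ difference ⟩
      (s * ½) * ((1# + 1#) * (s * odd n))
        ≈⟨ *-congʳ (*-comm s ½) ⟩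
      (½ * s) * ((1# + 1#) * (s * odd n))
        ≈⟨ *-interchange ½ s _ _ ⟩
      (½ * (1# + 1#)) * (s * (s * odd n))
        ≈⟨ *-cong (trans (*-comm _ _) 2½≈1) (trans (sym (*-assoc s s _)) (*-congʳ s²≈t)) ⟩
      1# * (t * odd n)
        ≈⟨ *-identityˡ _ ⟩
      t * odd n ∎)
      where
      -s²≈t : - s * - s ≈ t
      -s²≈t = begin
        - s * - s      ≈⟨ -‿distribˡ-* s (- s) ⟨
        - (s * - s)    ≈⟨ -‿cong (-‿distribʳ-* s s) ⟨
        - (- (s * s))  ≈⟨ -‿involutive _ ⟩
        s * s          ≈⟨ s²≈t ⟩
        t              ∎
      difference : (even n + s * odd n) - (even n + - s * odd n) ≈ (1# + 1#) * (s * odd n)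
      difference = begin
        (even n + s * odd n) - (even n + - s * odd n)
          ≈⟨ +-congˡ (-‿+-comm _ _) ⟨
        (even n + s * odd n) + (- even n + - (- s * odd n))
          ≈⟨ interchange _ _ _ _ ⟩
        (even n - even n) + (s * odd n + - (- s * odd n))
          ≈⟨ +-cong (-‿inverseʳ _) (+-congˡ (trans (-‿cong (sym (-‿distribˡ-* s _))) (-‿involutive _))) ⟩
        0# + (s * odd n + s * odd n)
          ≈⟨ +-identityˡ _ ⟩
        s * odd n + s * odd n
          ≈⟨ +-cong (*-identityˡ _) (*-identityˡ _) ⟨
        1# * (s * odd n) + 1# * (s * odd n)
          ≈⟨ distribʳ _ 1# 1# ⟨
        (1# + 1#) * (s * odd n) ∎

    ∑-binomial≈odd : ∀ n → (∑[ i ← map suc (upTo ⌈ n /2⌉) ] (n C (2 ℕ.* i ∸ 1)) · t ^ i) ≈ t * odd n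
    ∑-binomial≈odd n = begin
      _ ≈⟨ ∑-map suc (upTo ⌈ n /2⌉) _ ⟩
      (∑[ i ← upTo ⌈ n /2⌉ ] (n C (2 ℕ.* suc i ∸ 1)) · t ^ suc i)
        ≈⟨ ∑-cong (upTo ⌈ n /2⌉) (λ {i} _ → trans (×-congˡ (≡.cong (λ k → n C (k ∸ 1)) (2*suc i)))
             (sym (×-comm-* (n C suc (2 ℕ.* i)) t (t ^ i)))) ⟩
      (∑[ i ← upTo ⌈ n /2⌉ ] t * ((n C suc (2 ℕ.* i)) · t ^ i))
        ≈⟨ ∑-*ˡ (upTo ⌈ n /2⌉) t _ ⟩
      t * (∑[ i ← upTo ⌈ n /2⌉ ] (n C suc (2 ℕ.* i)) · t ^ i)
        ≈⟨ *-congˡ (∑-odd n ⌈ n /2⌉ n≤2⌈n/2⌉) ⟩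
      t * odd n ∎
      where
      n≤2⌈n/2⌉ : n ℕ.≤ 2 ℕ.* ⌈ n /2⌉
      n≤2⌈n/2⌉ = ≡.subst₂ ℕ._≤_ (ℕ.⌊n/2⌋+⌈n/2⌉≡n n)
        (≡.cong (⌈ n /2⌉ ℕ.+_) (≡.sym (ℕ.+-identityʳ _)))
        (ℕ.+-monoˡ-≤ ⌈ n /2⌉ (ℕ.⌊n/2⌋≤⌈n/2⌉ n))

theorem4p3 :
  ∀ {c ℓ} (R : CommutativeRing c ℓ) →
  let open CommutativeRing R
      open GeneratingFunction R
  in
  ∀ (n : ℕ) → 1 ℕ.≤ n →
  ∀ (t : Carrier) →
  let S = ∑[ i ← map suc (upTo ⌈ n /2⌉) ] (n C (2 ℕ.* i ∸ 1)) · t ^ i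
  in
  (Pnest n t ≈ S) ×
  (∀ (√t ½ : Carrier) → √t * √t ≈ t → (1# + 1#) * ½ ≈ 1# →
    S ≈ (√t * ½) * ((1# + √t) ^ n - (1# - √t) ^ n))
theorem4p3 R (suc n) _ t =
  trans (Pnest≈odd t n) (sym (∑-binomial≈odd t (suc n))) ,
  λ √t ½ √t²≈t 2½≈1 → trans (∑-binomial≈odd t (suc n)) (odd-closed-form t (suc n) √t ½ √t²≈t 2½≈1)
  where
  open CommutativeRing R using (trans; sym)
  open Sums R
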